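{- Let $\mathcal{L}\subseteq\mathrm{Scat}$ be nonempty, downward $\preceq$-closed and ccs. Then ${\trianglelefteq^{\mathcal{L}}_{\mathrm{LO}_{\mathbb{N}}}}\sim_B{\trianglelefteq^{\mathcal{L}}_{\mathrm{LO}}}$.
   Context: Linear orders are reflexive and nonempty. $L\preceq L'$ means there is an embedding $f:L\to L'$, i.e. $x\le_L y\iff f(x)\le_{L'}f(y)$. $\mathrm{LO}\subseteq 2^{\mathbb{N}\times\mathbb{N}}$ is the Polish space of codes for linear orders with domain $\mathbb{N}$; $\mathrm{Fin}$ is the set of codes for nonempty linear orders on finite subsets of $\mathbb{N}$; $\mathrm{Lin}=\mathrm{Fin}\cup\mathrm{LO}$; $\mathrm{Scat}\subseteq\mathrm{Lin}$ is the set of scattered ones (those $L$ with $\mathbb{Q}\not\preceq L$). A class $\mathcal{L}\subseteq\mathrm{Lin}$ is downward $\preceq$-closed if $K\in\mathrm{Lin}$ and $K\preceq L\in\mathcal{L}$ imply $K\in\mathcal{L}$; membership in $\mathcal{L}$ is meant up to isomorphism. A subset $I$ of a linear order $L$ is convex if $x\le_L y\le_L z$ and $x,z\in I$ imply $y\in I$. For $A,B\subseteq L$ write $A\le_L B$ (resp. $A<_L B$) if $a\le_L b$ (resp. $a<_L b$) for all $a\in A$, $b\in B$. A $K$-convex partition of $L$ is a partition $(L_k)_{k\in K}$ of $L$ (into nonempty sets) such that $k<_K k'\iff L_k<_L L_{k'}$. For $L,L'\in\mathrm{LO}$, $L\trianglelefteq^{\mathcal{L}}_{\mathrm{LO}}L'$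 holds iff there are $K\in\mathcal{L}$, a $K$-convex partition $(L_k)_{k\in K}$ of $L$, and an embedding $f$ of $L$ into $L'$ such that $f(L_k)$ is a convex subset of $L'$ for every $k\in K$; we then say that the embedding $f$ witnesses $L\trianglelefteq^{\mathcal{L}}_{\mathrm{LO}}L'$. The space of coloured linear orders is the Polish space $\mathrm{LO}_{\mathbb{N}}=\mathrm{LO}\times\mathbb{N}^{\mathbb{N}}$. For $(L,c),(L',c')\in\mathrm{LO}_{\mathbb{N}}$, $(L,c)\trianglelefteq^{\mathcal{L}}_{\mathrm{LO}_{\mathbb{N}}}(L',c')$ iff there is an embedding $f:L\to L'$ witnessing $L\trianglelefteq^{\mathcal{L}}_{\mathrm{LO}}L'$ with $c'(f(n))=c(n)$ for every $n\in\mathbb{N}$. $\mathcal{L}$ is ccs (closed under convex sums) if for all $K,K'\in\mathcal{L}$ and every family $(K'_k)_{k\in K}$ of nonempty convex subsets of $K'$ such that $k_0<_K k_1\Rightarrow K'_{k_0}\le_{K'}K'_{k_1}$, we have $\sum_{k\in K}K'_k\in\mathcal{L}$, where $\sum_{k\in K}K'_k=\{(x,k): k\in K, x\in K'_k\}$ ordered antilexicographically. For binary relations $E$ on $X$ and $F$ on $Y$, $E\le_B F$ means there is a Borel map $\varphi:X\to Y$ with $x\mathrel{E}x'\iff\varphi(x)\mathrel{F}\varphi(x')$; $E\sim_B F$ means $E\le_B F$ and $F\le_B E$. -}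

module Defs where

open import Level using (Setω; 0ℓ; _⊔_) renaming (suc to lsuc)
open import Axiom.ExcludedMiddle using (ExcludedMiddle)
open import Data.Bool.Base using (Bool; T)
open import Data.Nat.Base using (ℕ; _<_)
import Data.Nat.Properties as ℕ
import Data.Rational.Properties as ℚ
open import Data.Product.Base using (Σ; Σ-syntax; ∃; ∃-syntax; _×_; _,_; proj₁; proj₂)
open import Data.Product.Relation.Binary.Lex.NonStrict using (×-totalOrder)
open import Data.Sum.Base using (_⊎_; inj₁; inj₂)
open import Function.Base using (_on_)
open import Function.Bundles using (_⇔_)
open import Relation.Binary.Bundles using (TotalOrder; DecTotalOrder)
open import Relation.Binary.Core using (Rel)
open import Relation.Binary.Structures using (IsTotalOrder)
import Relation.Binary.Construct.On as On
import Relation.Binary.Construct.NonStrictToStrict as ToStrict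
import Relation.Binary.Properties.TotalOrder as TotalOrderProperties
open import Relation.Binary.PropositionalEquality.Core using (_≡_)
open import Relation.Nullary.Negation.Core using (¬_)
open import Relation.Unary using (Pred; _≐_; _⊢_; ∁; ⋃; Satisfiable)

-- The mathematics takes place in classical set theory.  As `Dec P` carries
-- an element of `P` in the positive case, this principle also provides choice.
Classical : Setω
Classical = ∀ {ℓ} → ExcludedMiddle ℓ

Order : Set₁
Order = TotalOrder 0ℓ 0ℓ 0ℓ

∣_∣ : Order → Set
∣ L ∣ = TotalOrder.Carrier L

module _ (L : Order) where
  open TotalOrder L

  Strict : Rel ∣ L ∣ 0ℓ
  Strict = ToStrict._<_ _≈_ _≤_

  IsConvex : Pred ∣ L ∣ 0ℓ → Set
  IsConvex I = ∀ {x y z} → x ≤ y → y ≤ z → I x → I z → I y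

  SetLe : Rel (Pred ∣ L ∣ 0ℓ) 0ℓ
  SetLe A B = ∀ {a b} → A a → B b → a ≤ b

  SetLt : Rel (Pred ∣ L ∣ 0ℓ) 0ℓ
  SetLt A B = ∀ {a b} → A a → B b → Strict a b

module _ (L L′ : Order) where
  private
    module L  = TotalOrder L
    module L′ = TotalOrder L′

  IsEmbedding : (∣ L ∣ → ∣ L′ ∣) → Set
  IsEmbedding f = ∀ x y → (x L.≤ y) ⇔ (f x L′.≤ f y)

  Image : (∣ L ∣ → ∣ L′ ∣) → Pred ∣ L ∣ 0ℓ → Pred ∣ L′ ∣ 0ℓ
  Image f A y = ∃[ x ] A x × f x L′.≈ y

  IsIsomorphism : (∣ L ∣ → ∣ L′ ∣) → Set
  IsIsomorphism f = IsEmbedding f × (∀ y → ∃[ x ] f x L′.≈ y)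

infix 4 _⪯_ _≅_

_⪯_ : Rel Order 0ℓ
L ⪯ L′ = ∃ (IsEmbedding L L′)

_≅_ : Rel Order 0ℓ
L ≅ L′ = ∃ (IsIsomorphism L L′)

ℚ-order : Order
ℚ-order = DecTotalOrder.totalOrder ℚ.≤-decTotalOrder

record ConvexPartition (K L : Order) : Set₁ where
  private
    module K = TotalOrder K
  field
    part     : ∣ K ∣ → Pred ∣ L ∣ 0ℓ
    nonempty : ∀ k → Satisfiable (part k)
    covers   : ∀ x → ∃[ k ] part k x
    disjoint : ∀ {k k′ x} → part k x → part k′ x → k K.≈ k′
    ordered  : ∀ k k′ → Strict K k k′ ⇔ SetLt L (part k) (part k′)

Code : Set
Code = ℕ → ℕ → Bool

-- A reflexive order on a subset of ℕ determines its domain.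
Dom : Code → Set
Dom r = Σ[ n ∈ ℕ ] T (r n n)

label : ∀ {r} → Dom r → ℕ
label = proj₁

Le : (r : Code) → Rel ℕ 0ℓ
Le r m n = T (r m n)

record IsLO (r : Code) : Set where
  field
    isTotalOrder : IsTotalOrder _≡_ (Le r)

record IsFin (r : Code) : Set where
  field
    supported    : ∀ {m n} → Le r m n → Le r m m × Le r n n
    inhabited    : Dom r
    finite       : ∃[ b ] (∀ (x : Dom r) → label {r} x < b)
    isTotalOrder : IsTotalOrder (_≡_ on label {r}) (Le r on label {r})

record LO : Set where
  constructor mkLO
  field
    code : Code
    isLO : IsLO code

record Lin : Set where
  constructor mkLin
  field
    code  : Code
    isLin : IsFin code ⊎ IsLO code

⟦_⟧ : LO → Order
⟦ L ⟧ = record { isTotalOrder = IsLO.isTotalOrder (LO.isLO L) }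

Lin-isTotalOrder : (L : Lin) → let r = Lin.code L in
                   IsTotalOrder (_≡_ on label {r}) (Le r on label {r})
Lin-isTotalOrder (mkLin r (inj₁ fin)) = IsFin.isTotalOrder fin
Lin-isTotalOrder (mkLin r (inj₂ lo))  = On.isTotalOrder (label {r}) (IsLO.isTotalOrder lo)

⟦_⟧ₗ : Lin → Order
⟦ L ⟧ₗ = record { isTotalOrder = Lin-isTotalOrder L }

Class : Set₁
Class = Pred Lin 0ℓ

Scat : Class
Scat L = ¬ (ℚ-order ⪯ ⟦ L ⟧ₗ)

DownwardClosed : Class → Set
DownwardClosed 𝓛 = ∀ {K L} → ⟦ K ⟧ₗ ⪯ ⟦ L ⟧ₗ → 𝓛 L → 𝓛 K

infix 4 _∈≅_

_∈≅_ : Order → Class → Set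
A ∈≅ 𝓛 = Σ[ M ∈ Lin ] 𝓛 M × A ≅ ⟦ M ⟧ₗ

Lin-decTotalOrder : Lin → DecTotalOrder 0ℓ 0ℓ 0ℓ
Lin-decTotalOrder L =
  TotalOrderProperties.decTotalOrder ⟦ L ⟧ₗ
    (On.decidable (label {Lin.code L}) _≡_ ℕ._≟_)

-- The sum of the suborders P k of K′ over k ∈ K.  The antilexicographic order
-- on pairs (x , k) is the lexicographic order on the swapped pairs (k , x); the
-- proofs of x ∈ P k are ignored by both the order and the equality.
ConvexSum : (K K′ : Lin) → (∣ ⟦ K ⟧ₗ ∣ → Pred ∣ ⟦ K′ ⟧ₗ ∣ 0ℓ) → Order
ConvexSum K K′ P =
  On.totalOrder (×-totalOrder (Lin-decTotalOrder K) ⟦ K′ ⟧ₗ) swapped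
  where
  swapped : (Σ[ x ∈ ∣ ⟦ K′ ⟧ₗ ∣ ] Σ[ k ∈ ∣ ⟦ K ⟧ₗ ∣ ] P k x) → ∣ ⟦ K ⟧ₗ ∣ × ∣ ⟦ K′ ⟧ₗ ∣
  swapped (x , k , _) = k , x

CCS : Class → Set₁
CCS 𝓛 =
  ∀ {K K′} → 𝓛 K → 𝓛 K′ →
  (P : ∣ ⟦ K ⟧ₗ ∣ → Pred ∣ ⟦ K′ ⟧ₗ ∣ 0ℓ) →
  (∀ k → Satisfiable (P k)) →
  (∀ k → IsConvex ⟦ K′ ⟧ₗ (P k)) →
  (∀ {k₀ k₁} → Strict ⟦ K ⟧ₗ k₀ k₁ → SetLe ⟦ K′ ⟧ₗ (P k₀) (P k₁)) →
  ConvexSum K K′ P ∈≅ 𝓛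

record Witnesses (𝓛 : Class) (L L′ : LO) (f : ℕ → ℕ) : Set₁ where
  field
    embedding : IsEmbedding ⟦ L ⟧ ⟦ L′ ⟧ f
    K         : Lin
    K∈𝓛       : 𝓛 K
    partition : ConvexPartition ⟦ K ⟧ₗ ⟦ L ⟧
  open ConvexPartition partition
  field
    convex    : ∀ k → IsConvex ⟦ L′ ⟧ (Image ⟦ L ⟧ ⟦ L′ ⟧ f (part k))

LOℕ : Set
LOℕ = LO × (ℕ → ℕ)

⊴LO : Class → Rel LO (lsuc 0ℓ)
⊴LO 𝓛 L L′ = ∃[ f ] Witnesses 𝓛 L L′ f

⊴LOℕ : Class → Rel LOℕ (lsuc 0ℓ)
⊴LOℕ 𝓛 (L , c) (L′ , c′) = ∃[ f ] Witnesses 𝓛 L L′ f × (∀ n → c′ (f n) ≡ c n)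

-- A topology given by a countable neighbourhood base at each point:
-- the n-th basic neighbourhood of x is { y ∣ Agree n x y }.
record Space : Set₁ where
  field
    Point : Set
    Agree : ℕ → Rel Point 0ℓ

open Space using (Point) public

IsOpen : (X : Space) → Pred (Pred (Point X) 0ℓ) 0ℓ
IsOpen X U = ∀ {x} → U x → ∃[ n ] (∀ y → Space.Agree X n x y → U y)

-- The subspace topology from the product 2^(ℕ×ℕ) of discrete spaces.
LO-space : Space
LO-space = record
  { Point = LO
  ; Agree = λ n L L′ → ∀ {i j} → i < n → j < n → LO.code L i j ≡ LO.code L′ i j
  }

Baire-space : Space
Baire-space = record
  { Point = ℕ → ℕ
  ; Agree = λ n c c′ → ∀ {i} → i < n → c i ≡ c′ i
  }

_×ₛ_ : Space → Space → Space
X ×ₛ Y = record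
  { Point = Point X × Point Y
  ; Agree = λ n (x , y) (x′ , y′) → Space.Agree X n x x′ × Space.Agree Y n y y′
  }

LOℕ-space : Space
LOℕ-space = LO-space ×ₛ Baire-space

data IsBorel (X : Space) : Pred (Point X) 0ℓ → Set₁ where
  isOpen     : ∀ {U} → IsOpen X U → IsBorel X U
  complement : ∀ {U} → IsBorel X U → IsBorel X (∁ U)
  union      : ∀ {U : ℕ → Pred (Point X) 0ℓ} → (∀ n → IsBorel X (U n)) → IsBorel X (⋃ ℕ U)
  respects   : ∀ {U V} → U ≐ V → IsBorel X U → IsBorel X V

IsBorelMap : (X Y : Space) → (Point X → Point Y) → Set₁
IsBorelMap X Y φ = ∀ {U} → IsBorel Y U → IsBorel X (φ ⊢ U)

BorelReducible : ∀ {e f} (X Y : Space) → Rel (Point X) e → Rel (Point Y) f → Set (lsuc 0ℓ ⊔ e ⊔ f)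
BorelReducible X Y E F =
  ∃[ φ ] IsBorelMap X Y φ × (∀ x x′ → E x x′ ⇔ F (φ x) (φ x′))

BorelEquivalent : ∀ {e f} (X Y : Space) → Rel (Point X) e → Rel (Point Y) f → Set (lsuc 0ℓ ⊔ e ⊔ f)
BorelEquivalent X Y E F = BorelReducible X Y E F × BorelReducible Y X F E

{-# OPTIONS --safe #-}
module Submission where

-- A constant colouring reduces orders to coloured orders.  For the other
-- reduction, `inflate` replaces every point n of a coloured order (L , c) by a
-- sum of blocks, one for each position q in a fixed countable order without
-- least element.  The block at q has order type s + ω*, and its length
-- s = size (c n) q determines both the colour c n and the position q.  The
-- inflated order depends continuously on (L , c), and an embedding f witnessing
-- the relation between coloured orders induces (n , q , i) ↦ (f n , q , i)
-- between the inflated orders, with the same index K (`inflate-preserves`).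
--
-- Conversely, let G witness the relation between two inflated orders, with
-- pieces indexed by K.  Since the image of a piece is convex, G preserves and
-- reflects immediate predecessors and successors inside a piece.  The heads of
-- the blocks are exactly the points without immediate predecessor, and from
-- each head a chain of immediate successors of length exactly s starts.  So a
-- block which lies in one piece together with some earlier point, a "good" one,
-- has its head sent to the head of a block of the same length, that is, of the
-- same colour and at the same position (`recognise`).  This gives a target n′
-- for each good (n , q).
--
-- Positions form ω* many copies of ℚ.  Each copy contains a good position of
-- each n, as otherwise K would contain a copy of ℚ (`good-in-row`).  Choose a
-- good position of each n and let f n be its target.  If m < n had the same
-- target, a good position of n below both chosen positions would have that
-- target too, and its head would be sent below the image of an earlier point;
-- so f is strictly increasing (`targets-monotone`).  Finally, put m and n in
-- one class if their chosen heads lie in one piece.  For such m < n every point t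
-- between f m and f n is a value of f on that class: the head of the block at (t , r) is the
-- image of the head of some good (k , r) (`fill-head`), and all good positions
-- of k in one piece have the same target (`target-constant`).  The classes are
-- indexed by a suborder of K, which belongs to 𝓛 by downward closure.

open import Defs
open import Level using (0ℓ)
open import Data.Bool.Base using (T; _∧_)
open import Data.Bool.Properties using (T-∧; T-irrelevant)
open import Data.Empty using (⊥-elim)
open import Data.Integer.Base using (ℤ; +_; -[1+_])
open import Data.Nat.Base using (ℕ; zero; suc; _+_; _*_; _≤_; _<_; z≤n; s≤s; s≤s⁻¹; _∸_; _⊔_)
import Data.Nat.Properties as ℕ
open import Data.Product.Base using (Σ-syntax; ∃; ∃-syntax; _×_; _,_; proj₁; proj₂)
open import Data.Rational.Base as ℚ using (ℚ; mkℚ)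
import Data.Rational.Properties as ℚ
open import Data.Sum.Base using (_⊎_; inj₁; inj₂; [_,_]′)
open import Function.Base using (_∘_; flip; id)
open import Function.Bundles using (mk⇔; Equivalence; _↔_; mk↔ₛ′; Inverse)
open import Function.Definitions using (Injective)
open import Relation.Binary.Bundles using (TotalOrder)
open import Relation.Binary.Core using (Rel)
open import Relation.Binary.Definitions using (Trichotomous; Tri; tri<; tri≈; tri>; Transitive)
open import Relation.Binary.Structures using (IsTotalOrder; IsStrictTotalOrder)
open import Relation.Binary.Structures.Biased using (isStrictTotalOrderᶜ)
import Relation.Binary.Construct.Flip.EqAndOrd as Flip
import Relation.Binary.Construct.NonStrictToStrict as ToStrict
import Relation.Binary.Construct.StrictToNonStrict as ToNonStrict
open import Relation.Binary.PropositionalEquality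
open import Relation.Nullary using (¬_; Dec; yes; no; contradiction; ⌊_⌋)
open import Relation.Nullary.Decidable using (toWitness; fromWitness; isYes≗does; does-⇔; decidable-stable)
open import Relation.Unary using (Pred; Decidable; _⊆_; Satisfiable)

private
  variable
    A B : Set

-- Enumerating infinite sets of natural numbers

Unbounded : Pred ℕ 0ℓ → Set
Unbounded S = ∀ n → ∃[ m ] n ≤ m × S m

module _ {S : Pred ℕ 0ℓ} (S? : Decidable S) where

  -- m is the least element of S that is at least n.
  LeastFrom : ℕ → ℕ → Set
  LeastFrom n m = n ≤ m × S m × (∀ {t} → n ≤ t → t < m → ¬ S t)

  -- The search takes at most k steps, k being the distance to a known element.
  least : ∀ k n → S (k + n) → ∃ (LeastFrom n)
  least zero n s = n , ℕ.≤-refl , s , λ n≤t t<n → contradiction t<n (ℕ.≤⇒≯ n≤t)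
  least (suc k) n s with S? n
  ... | yes sn = n , ℕ.≤-refl , sn , λ n≤t t<n → contradiction t<n (ℕ.≤⇒≯ n≤t)
  ... | no ¬sn with m , n<m , sm , below ← least k (suc n) (subst S (sym (ℕ.+-suc k n)) s) =
    m , ℕ.<⇒≤ n<m , sm , λ n≤t t<m → [ (λ n<t → below n<t t<m) , (λ { refl → ¬sn }) ]′ (ℕ.m≤n⇒m<n∨m≡n n≤t)

  module _ (unbounded : Unbounded S) where

    leastFrom : ∀ n → ∃ (LeastFrom n)
    leastFrom n with m , n≤m , s ← unbounded n =
      least (m ∸ n) n (subst S (sym (ℕ.m∸n+n≡m n≤m)) s)

    -- The increasing enumeration of S.
    nth : ℕ → ℕ
    nth zero    = proj₁ (leastFrom zero)
    nth (suc n) = proj₁ (leastFrom (suc (nth n)))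

    nth-∈ : ∀ n → S (nth n)
    nth-∈ zero    = proj₁ (proj₂ (proj₂ (leastFrom zero)))
    nth-∈ (suc n) = proj₁ (proj₂ (proj₂ (leastFrom (suc (nth n)))))

    nth-suc : ∀ n → nth n < nth (suc n)
    nth-suc n = proj₁ (proj₂ (leastFrom (suc (nth n))))

    nth-mono : ∀ {m n} → m < n → nth m < nth n
    nth-mono {m} {suc n} (s≤s m≤n) with ℕ.m≤n⇒m<n∨m≡n m≤n
    ... | inj₁ m<n  = ℕ.<-trans (nth-mono m<n) (nth-suc n)
    ... | inj₂ refl = nth-suc n

    nth-injective : Injective _≡_ _≡_ nth
    nth-injective {m} {n} eq with ℕ.<-cmp m n
    ... | tri< m<n _ _ = contradiction eq (ℕ.<⇒≢ (nth-mono m<n))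
    ... | tri≈ _ m≡n _ = m≡n
    ... | tri> _ _ n<m = contradiction (sym eq) (ℕ.<⇒≢ (nth-mono n<m))

    n≤nth : ∀ n → n ≤ nth n
    n≤nth zero    = z≤n
    n≤nth (suc n) = ℕ.≤-<-trans (n≤nth n) (nth-suc n)

    nth-surjective-≤ : ∀ {t} → S t → ∀ n → t ≤ nth n → ∃[ m ] nth m ≡ t
    nth-surjective-≤ {t} st n t≤ with ℕ.m≤n⇒m<n∨m≡n t≤
    ... | inj₂ eq = n , sym eq
    nth-surjective-≤ st zero    _ | inj₁ t< =
      contradiction st (proj₂ (proj₂ (proj₂ (leastFrom zero))) z≤n t<)
    nth-surjective-≤ {t} st (suc n) _ | inj₁ t< with ℕ.≤-<-connex t (nth n)
    ... | inj₁ t≤n = nth-surjective-≤ st n t≤n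
    ... | inj₂ n<t =
      contradiction st (proj₂ (proj₂ (proj₂ (leastFrom (suc (nth n))))) n<t t<)

    nth-surjective : ∀ {t} → S t → ∃[ m ] nth m ≡ t
    nth-surjective {t} st = nth-surjective-≤ st t (n≤nth t)

-- An infinite type that injects into ℕ is in bijection with ℕ.
ℕ↔ : Classical → (ι : A → ℕ) → Injective _≡_ _≡_ ι → (∀ n → ∃[ a ] n ≤ ι a) → ℕ ↔ A
ℕ↔ {A} em ι ι-injective ι-unbounded = mk↔ₛ′ to from to∘from from∘to
  where
  S : Pred ℕ 0ℓ
  S t = ∃[ a ] ι a ≡ t
  S? : Decidable S
  S? t = em
  S-unbounded : Unbounded S
  S-unbounded n with a , n≤ ← ι-unbounded n = ι a , n≤ , a , refl
  to : ℕ → A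
  to n = proj₁ (nth-∈ S? S-unbounded n)
  ι∘to : ∀ n → ι (to n) ≡ nth S? S-unbounded n
  ι∘to n = proj₂ (nth-∈ S? S-unbounded n)
  from : A → ℕ
  from a = proj₁ (nth-surjective S? S-unbounded (a , refl))
  nth∘from : ∀ a → nth S? S-unbounded (from a) ≡ ι a
  nth∘from a = proj₂ (nth-surjective S? S-unbounded (a , refl))
  to∘from : ∀ a → to (from a) ≡ a
  to∘from a = ι-injective (trans (ι∘to (from a)) (nth∘from a))
  from∘to : ∀ n → from (to n) ≡ n
  from∘to n = nth-injective S? S-unbounded (trans (nth∘from (to n)) (ι∘to n))

-- An injection ℕ × ℕ → ℕ: the value is at least s² and less than
-- (s + 1)², where s = a + b.
pair : ℕ → ℕ → ℕ
pair a b = (a + b) * (a + b) + a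

pair-<-sum : ∀ {a b a′ b′} → a + b < a′ + b′ → pair a b < pair a′ b′
pair-<-sum {a} {b} {a′} {b′} s<s′ = begin-strict
  s * s + a      ≤⟨ ℕ.+-monoʳ-≤ (s * s) (ℕ.m≤m+n a b) ⟩
  s * s + s      ≡⟨ ℕ.+-comm (s * s) s ⟩
  suc s * s      <⟨ ℕ.*-monoʳ-< (suc s) (ℕ.n<1+n s) ⟩
  suc s * suc s  ≤⟨ ℕ.*-mono-≤ s<s′ s<s′ ⟩
  s′ * s′        ≤⟨ ℕ.m≤m+n (s′ * s′) a′ ⟩
  s′ * s′ + a′   ∎
  where
  open ℕ.≤-Reasoning
  s  = a + b
  s′ = a′ + b′

pair-injective : ∀ {a b a′ b′} → pair a b ≡ pair a′ b′ → a ≡ a′ × b ≡ b′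
pair-injective {a} {b} {a′} {b′} eq with ℕ.<-cmp (a + b) (a′ + b′)
... | tri< lt _ _ = contradiction eq (ℕ.<⇒≢ (pair-<-sum {a} {b} {a′} {b′} lt))
... | tri> _ _ gt = contradiction (sym eq) (ℕ.<⇒≢ (pair-<-sum {a′} {b′} {a} {b} gt))
... | tri≈ _ s≡s′ _ = a≡a′ , ℕ.+-cancelˡ-≡ a b b′ (trans s≡s′ (cong (_+ b′) (sym a≡a′)))
  where
  a≡a′ : a ≡ a′
  a≡a′ = ℕ.+-cancelˡ-≡ ((a + b) * (a + b)) a a′
           (trans eq (cong (λ s → s * s + a′) (sym s≡s′)))

m≤pair : ∀ m n → m ≤ pair m n
m≤pair m n = ℕ.m≤n+m m _

ℤ-index : ℤ → ℕ
ℤ-index (+ n)    = pair 0 n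
ℤ-index -[1+ n ] = pair 1 n

ℤ-index-injective : Injective _≡_ _≡_ ℤ-index
ℤ-index-injective {+ m} {+ n} eq = cong +_ (proj₂ (pair-injective {0} {m} {0} {n} eq))
ℤ-index-injective {+ m} { -[1+ n ]} eq = contradiction (proj₁ (pair-injective {0} {m} {1} {n} eq)) λ ()
ℤ-index-injective { -[1+ m ]} {+ n} eq = contradiction (proj₁ (pair-injective {1} {m} {0} {n} eq)) λ ()
ℤ-index-injective { -[1+ m ]} { -[1+ n ]} eq = cong -[1+_] (proj₂ (pair-injective {1} {m} {1} {n} eq))

ℚ-index : ℚ → ℕ
ℚ-index x = pair (ℤ-index (ℚ.numerator x)) (ℚ.denominator-1 x)

ℚ-index-injective : Injective _≡_ _≡_ ℚ-index
ℚ-index-injective {mkℚ m d _} {mkℚ n e _} eq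
  with m≡n , d≡e ← pair-injective {ℤ-index m} {d} {ℤ-index n} {e} eq =
  ℚ.mkℚ-cong (ℤ-index-injective m≡n) d≡e

-- Lexicographic sums and blocks

-- The sum over an order on A of orders on B that may depend on the summand.
data LexSum (_<ᴬ_ : Rel A 0ℓ) (_<ᴮ[_]_ : B → A → B → Set) : Rel (A × B) 0ℓ where
  outer : ∀ {a a′ b b′} → a <ᴬ a′ → LexSum _<ᴬ_ _<ᴮ[_]_ (a , b) (a′ , b′)
  inner : ∀ {a b b′} → b <ᴮ[ a ] b′ → LexSum _<ᴬ_ _<ᴮ[_]_ (a , b) (a , b′)

LexSum-isStrictTotalOrder :
  {_<ᴬ_ : Rel A 0ℓ} {_<ᴮ[_]_ : B → A → B → Set} →
  IsStrictTotalOrder _≡_ _<ᴬ_ → (∀ a → IsStrictTotalOrder _≡_ (_<ᴮ[ a ]_)) →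
  IsStrictTotalOrder _≡_ (LexSum _<ᴬ_ _<ᴮ[_]_)
LexSum-isStrictTotalOrder {_<ᴬ_ = _<ᴬ_} {_<ᴮ[_]_} <ᴬ-sto <ᴮ-sto = isStrictTotalOrderᶜ record
  { isEquivalence = isEquivalence
  ; trans         = <-trans
  ; compare       = <-compare
  }
  where
  module 𝔸 = IsStrictTotalOrder <ᴬ-sto
  module 𝔹 a = IsStrictTotalOrder (<ᴮ-sto a)
  _≺_ = LexSum _<ᴬ_ _<ᴮ[_]_

  <-trans : Transitive _≺_
  <-trans (outer p) (outer q) = outer (𝔸.trans p q)
  <-trans (outer p) (inner q) = outer p
  <-trans (inner p) (outer q) = outer q
  <-trans (inner p) (inner q) = inner (𝔹.trans _ p q)

  <-compare : Trichotomous _≡_ _≺_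
  <-compare (a , b) (a′ , b′) with 𝔸.compare a a′
  ... | tri< p ¬q ¬r = tri< (outer p) (λ { refl → ¬q refl })
                            (λ { (outer r) → ¬r r ; (inner _) → ¬q refl })
  ... | tri> ¬p ¬q r = tri> (λ { (outer p) → ¬p p ; (inner _) → ¬q refl })
                            (λ { refl → ¬q refl }) (outer r)
  ... | tri≈ ¬p refl ¬r with 𝔹.compare a b b′
  ...   | tri< p ¬q ¬s = tri< (inner p) (λ { refl → ¬q refl })
                              (λ { (outer r) → ¬r r ; (inner s) → ¬s s })
  ...   | tri> ¬s ¬q p = tri> (λ { (outer r) → ¬r r ; (inner s) → ¬s s })
                              (λ { refl → ¬q refl }) (inner p)
  ...   | tri≈ ¬s refl ¬p′ = tri≈ (λ { (outer r) → ¬r r ; (inner s) → ¬s s }) refl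
                              (λ { (outer r) → ¬r r ; (inner s) → ¬p′ s })

-- The order s + ω* on ℕ: the numbers below s in increasing order, followed by
-- the others in decreasing order.  For positive s its least element is 0, and s
-- is its greatest element.
Block : ℕ → Rel ℕ 0ℓ
Block s i j = (i < j × i < s) ⊎ (j < i × s ≤ j)

Block-isStrictTotalOrder : ∀ s → IsStrictTotalOrder _≡_ (Block s)
Block-isStrictTotalOrder s = isStrictTotalOrderᶜ record
  { isEquivalence = isEquivalence
  ; trans         = ◁-trans
  ; compare       = ◁-compare
  }
  where
  ◁-trans : Transitive (Block s)
  ◁-trans (inj₁ (i<j , i<s)) (inj₁ (j<k , _))   = inj₁ (ℕ.<-trans i<j j<k , i<s)
  ◁-trans (inj₁ (i<j , i<s)) (inj₂ (k<j , s≤k)) = inj₁ (ℕ.<-≤-trans i<s s≤k , i<s)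
  ◁-trans (inj₂ (j<i , s≤j)) (inj₁ (_ , j<s))   = contradiction j<s (ℕ.≤⇒≯ s≤j)
  ◁-trans (inj₂ (j<i , s≤j)) (inj₂ (k<j , s≤k)) = inj₂ (ℕ.<-trans k<j j<i , s≤k)

  asym : ∀ {i j} → Block s i j → ¬ Block s j i
  asym (inj₁ (i<j , _))   (inj₁ (j<i , _))   = ℕ.<-asym i<j j<i
  asym (inj₁ (_ , i<s))   (inj₂ (_ , s≤i))   = ℕ.<⇒≱ i<s s≤i
  asym (inj₂ (_ , s≤j))   (inj₁ (_ , j<s))   = ℕ.<⇒≱ j<s s≤j
  asym (inj₂ (j<i , _))   (inj₂ (i<j , _))   = ℕ.<-asym i<j j<i

  irrefl : ∀ {i j} → i ≡ j → ¬ Block s i j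
  irrefl refl (inj₁ (i<i , _)) = ℕ.<-irrefl refl i<i
  irrefl refl (inj₂ (i<i , _)) = ℕ.<-irrefl refl i<i

  lt : ∀ {i j} → Block s i j → Tri (Block s i j) (i ≡ j) (Block s j i)
  lt p = tri< p (flip irrefl p) (asym p)

  gt : ∀ {i j} → Block s j i → Tri (Block s i j) (i ≡ j) (Block s j i)
  gt p = tri> (asym p) (λ eq → irrefl (sym eq) p) p

  ◁-compare : Trichotomous _≡_ (Block s)
  ◁-compare i j with ℕ.<-cmp i j
  ... | tri≈ _ eq _ = tri≈ (irrefl eq) eq (irrefl (sym eq))
  ... | tri< i<j _ _ with ℕ.<-≤-connex i s
  ...   | inj₁ i<s = lt (inj₁ (i<j , i<s))
  ...   | inj₂ s≤i = gt (inj₂ (i<j , s≤i))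
  ◁-compare i j | tri> _ _ j<i with ℕ.<-≤-connex j s
  ...   | inj₁ j<s = gt (inj₁ (j<i , j<s))
  ...   | inj₂ s≤j = lt (inj₂ (j<i , s≤j))

block-least : ∀ s i → 0 < s → 0 ≡ i ⊎ Block s 0 i
block-least s zero    0<s = inj₁ refl
block-least s (suc i) 0<s = inj₂ (inj₁ (s≤s z≤n , 0<s))

block-above : ∀ {s i j} → i < s → Block s i j → i < j
block-above i<s (inj₁ (i<j , _))   = i<j
block-above i<s (inj₂ (j<i , s≤j)) = contradiction i<s (ℕ.≤⇒≯ (ℕ.≤-trans s≤j (ℕ.<⇒≤ j<i)))

block-greatest : ∀ s i → i ≡ s ⊎ Block s i s
block-greatest s i with ℕ.<-cmp i s
... | tri< i<s _ _ = inj₂ (inj₁ (i<s , i<s))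
... | tri≈ _ eq _  = inj₁ eq
... | tri> _ _ s<i = inj₂ (inj₂ (s<i , ℕ.≤-refl))

-- Inflating a coloured order

-- The second component ranges over ℚ and the first over ω*, that is, over ℕ
-- with the order reversed.  Thus below every position lies a whole copy of ℚ.
Position : Set
Position = ℕ × ℚ

-- The site (n , q) is the position q in the sum that replaces the point n.
Site : Set
Site = ℕ × Position

-- The point (σ , i) is the element i of the block at the site σ.
Pt : Set
Pt = Site × ℕ

infix 4 _<ₚ_

_<ₚ_ : Rel Position 0ℓ
_<ₚ_ = LexSum (flip _<_) (λ x _ y → x ℚ.< y)

<ₚ-isStrictTotalOrder : IsStrictTotalOrder _≡_ _<ₚ_
<ₚ-isStrictTotalOrder =
  LexSum-isStrictTotalOrder (Flip.isStrictTotalOrder ℕ.<-isStrictTotalOrder)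
                            (λ _ → ℚ.<-isStrictTotalOrder)

module Pos = IsStrictTotalOrder <ₚ-isStrictTotalOrder

<-+1 : ∀ x → x ℚ.< x ℚ.+ ℚ.1ℚ
<-+1 x = subst (ℚ._< x ℚ.+ ℚ.1ℚ) (ℚ.+-identityʳ x) (ℚ.+-monoʳ-< x (toWitness {a? = ℚ.0ℚ ℚ.<? ℚ.1ℚ} _))

<ₚ-dense : ∀ {p q} → p <ₚ q → ∃[ r ] p <ₚ r × r <ₚ q
<ₚ-dense {j , x} (outer k<j) = (j , x ℚ.+ ℚ.1ℚ) , inner (<-+1 x) , outer k<j
<ₚ-dense {j , x} (inner x<y) with z , x<z , z<y ← ℚ.<-dense x<y = (j , z) , inner x<z , inner z<y

position-index : Position → ℕ
position-index (j , x) = pair j (ℚ-index x)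

position-index-injective : Injective _≡_ _≡_ position-index
position-index-injective {j , x} {k , y} eq
  with j≡k , x≡y ← pair-injective {j} {ℚ-index x} {k} {ℚ-index y} eq =
  cong₂ _,_ j≡k (ℚ-index-injective x≡y)

-- The length of the increasing part of the block at position q over a point of
-- colour a.  It is positive, so that 0 is always the least element of the block.
size : ℕ → Position → ℕ
size a q = suc (pair a (position-index q))

size-injective : ∀ {a b p q} → size a p ≡ size b q → a ≡ b × p ≡ q
size-injective {a} {b} {p} {q} eq
  with a≡b , p≡q ← pair-injective {a} {position-index p} {b} {position-index q} (ℕ.suc-injective eq) =
  a≡b , position-index-injective p≡q

Pt-index : Pt → ℕ
Pt-index ((n , q) , i) = pair (pair n (position-index q)) i

Pt-index-injective : Injective _≡_ _≡_ Pt-index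
Pt-index-injective {(m , p) , i} {(n , q) , j} eq
  with eq′ , i≡j ← pair-injective {pair m (position-index p)} {i} {pair n (position-index q)} {j} eq
  with m≡n , p≡q ← pair-injective {m} {position-index p} {n} {position-index q} eq′ =
  cong₂ _,_ (cong₂ _,_ m≡n (position-index-injective p≡q)) i≡j

-- An arbitrary position.
origin : Position
origin = 0 , ℚ.0ℚ

Pt-index-unbounded : ∀ n → ∃[ a ] n ≤ Pt-index a
Pt-index-unbounded n = ((n , origin) , 0) ,
  ℕ.≤-trans (m≤pair n (position-index origin)) (m≤pair (pair n (position-index origin)) 0)

-- The strict part of the order coded by L.
_<[_]_ : ℕ → LO → ℕ → Set
m <[ L ] n = Strict ⟦ L ⟧ m n

<[]-isStrictTotalOrder : ∀ L → IsStrictTotalOrder _≡_ (_<[ L ]_)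
<[]-isStrictTotalOrder L =
  ToStrict.<-isStrictTotalOrder₁ _≡_ _ ℕ._≟_ (IsLO.isTotalOrder (LO.isLO L))

-- The strict order ≺ on points that inflates (L , c).
module Inflation (L : LO) (c : ℕ → ℕ) where

  infix 4 _<ₛ_ _≺_ _≼_ _⋖_

  module 𝕃 = IsStrictTotalOrder (<[]-isStrictTotalOrder L)

  _<ₛ_ : Rel Site 0ℓ
  _<ₛ_ = LexSum (_<[ L ]_) (λ p _ q → p <ₚ q)

  <ₛ-isStrictTotalOrder : IsStrictTotalOrder _≡_ _<ₛ_
  <ₛ-isStrictTotalOrder =
    LexSum-isStrictTotalOrder (<[]-isStrictTotalOrder L) (λ _ → <ₚ-isStrictTotalOrder)

  -- Below a position in copy j of ℚ lies all of copy suc j.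
  <ₛ-dense : ∀ {ρ σ} → ρ <ₛ σ → ∃[ τ ] ρ <ₛ τ × τ <ₛ σ
  <ₛ-dense {_} {n , j , x} (outer m<n) =
    (n , suc j , x) , outer m<n , inner (outer (ℕ.n<1+n j))
  <ₛ-dense (inner p<q) with r , p<r , r<q ← <ₚ-dense p<q = (_ , r) , inner p<r , inner r<q

  length : Site → ℕ
  length (n , q) = size (c n) q

  _≺_ : Rel Pt 0ℓ
  _≺_ = LexSum _<ₛ_ (λ i σ j → Block (length σ) i j)

  ≺-isStrictTotalOrder : IsStrictTotalOrder _≡_ _≺_
  ≺-isStrictTotalOrder =
    LexSum-isStrictTotalOrder <ₛ-isStrictTotalOrder (λ σ → Block-isStrictTotalOrder (length σ))

  module ≺ = IsStrictTotalOrder ≺-isStrictTotalOrder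

  _≼_ : Rel Pt 0ℓ
  _≼_ = ToNonStrict._≤_ _≡_ _≺_

  ≼-isTotalOrder : IsTotalOrder _≡_ _≼_
  ≼-isTotalOrder = ToNonStrict.isTotalOrder _≡_ _≺_ ≺-isStrictTotalOrder

  module ≼ = IsTotalOrder ≼-isTotalOrder

  _≼?_ : ∀ x y → Dec (x ≼ y)
  _≼?_ = ToNonStrict.decidable _≡_ _≺_ ≺._≟_ ≺._<?_

  -- y is an immediate successor of x.
  _⋖_ : Rel Pt 0ℓ
  x ⋖ y = x ≺ y × (∀ {w} → x ≺ w → ¬ w ≺ y)

  ⋖-unique : ∀ {x y y′} → x ⋖ y → x ⋖ y′ → y ≡ y′
  ⋖-unique {x} {y} {y′} (x≺y , gap) (x≺y′ , gap′) with ≺.compare y y′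
  ... | tri< y≺y′ _ _ = contradiction y≺y′ (gap′ x≺y)
  ... | tri≈ _ eq _   = eq
  ... | tri> _ _ y′≺y = contradiction y′≺y (gap x≺y′)

  head-least : ∀ σ i → (σ , 0) ≼ (σ , i)
  head-least σ i with block-least (length σ) i (s≤s z≤n)
  ... | inj₁ refl = inj₂ refl
  ... | inj₂ 0<i  = inj₁ (inner 0<i)

  last-greatest : ∀ σ i → (σ , i) ≼ (σ , length σ)
  last-greatest σ i with block-greatest (length σ) i
  ... | inj₁ refl = inj₂ refl
  ... | inj₂ i<s  = inj₁ (inner i<s)

  <ₛ-last : ∀ {σ τ} → (σ , 0) ≺ (τ , 0) → (σ , length σ) ≺ (τ , 0)
  <ₛ-last (outer σ<τ) = outer σ<τ
  <ₛ-last (inner 0<0) = contradiction 0<0 (IsStrictTotalOrder.irrefl (Block-isStrictTotalOrder _) refl)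

  head-compare : ∀ {m n p q} → ((m , p) , 0) ≺ ((n , q) , 0) → m <[ L ] n ⊎ (m ≡ n × p <ₚ q)
  head-compare (outer (outer m<n)) = inj₁ m<n
  head-compare (outer (inner p<q)) = inj₂ (refl , p<q)
  head-compare (inner 0<0)         =
    contradiction 0<0 (IsStrictTotalOrder.irrefl (Block-isStrictTotalOrder _) refl)

  head-squeeze : ∀ {n k p q r} → ((n , p) , 0) ≺ ((k , r) , 0) → ((k , r) , 0) ≺ ((n , q) , 0) →
                 p <ₚ r × r <ₚ q
  head-squeeze n≺k k≺n with head-compare n≺k | head-compare k≺n
  ... | inj₂ (_ , p<r)    | inj₂ (_ , r<q)    = p<r , r<q
  ... | inj₁ n<k          | inj₁ k<n          = contradiction k<n (𝕃.asym n<k)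
  ... | inj₁ n<k          | inj₂ (refl , _)   = contradiction n<k (𝕃.irrefl refl)
  ... | inj₂ (refl , _)   | inj₁ k<n          = contradiction k<n (𝕃.irrefl refl)

  -- Densely many sites precede σ, so the head of its block is a limit from below.
  head-no-predecessor : ∀ {w σ} → ¬ (w ⋖ (σ , 0))
  head-no-predecessor (outer ρ<σ , gap) with τ , ρ<τ , τ<σ ← <ₛ-dense ρ<σ =
    gap {τ , 0} (outer ρ<τ) (outer τ<σ)
  head-no-predecessor (inner (inj₁ (() , _)) , _)
  head-no-predecessor (inner (inj₂ (_ , ())) , _)

  inner-⋖ : ∀ {σ i j} → Block (length σ) i j →
            (∀ {k} → Block (length σ) i k → ¬ Block (length σ) k j) → (σ , i) ⋖ (σ , j)
  inner-⋖ i<j gap = inner i<j , λ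
    { (outer σ<τ) (outer τ<σ) → IsStrictTotalOrder.asym <ₛ-isStrictTotalOrder σ<τ τ<σ
    ; (outer σ<σ) (inner _)   → IsStrictTotalOrder.irrefl <ₛ-isStrictTotalOrder refl σ<σ
    ; (inner _)   (outer σ<σ) → IsStrictTotalOrder.irrefl <ₛ-isStrictTotalOrder refl σ<σ
    ; (inner i<k) (inner k<j) → gap i<k k<j
    }

  chain-⋖ : ∀ {σ i} → suc i < length σ → (σ , i) ⋖ (σ , suc i)
  chain-⋖ {σ} {i} 1+i<s = inner-⋖ (inj₁ (ℕ.n<1+n i , ℕ.<⇒≤ 1+i<s)) λ
    { (inj₁ (i<k , _)) (inj₁ (k<1+i , _)) → ℕ.<⇒≱ i<k (s≤s⁻¹ k<1+i)
    ; _                (inj₂ (_ , s≤1+i)) → ℕ.<⇒≱ 1+i<s s≤1+i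
    ; (inj₂ (k<i , s≤k)) _ → ℕ.<⇒≱ (ℕ.<-trans (ℕ.n<1+n i) 1+i<s) (ℕ.≤-trans s≤k (ℕ.<⇒≤ k<i))
    }

  tail-⋖ : ∀ {σ i} → length σ ≤ i → (σ , suc i) ⋖ (σ , i)
  tail-⋖ {σ} {i} s≤i = inner-⋖ (inj₂ (ℕ.n<1+n i , s≤i)) λ
    { (inj₁ (_ , 1+i<s)) _ → ℕ.<⇒≱ 1+i<s (ℕ.m≤n⇒m≤1+n s≤i)
    ; (inj₂ (_ , s≤k)) (inj₁ (_ , k<s)) → ℕ.<⇒≱ k<s s≤k
    ; (inj₂ (k<1+i , _)) (inj₂ (i<k , _)) → ℕ.<⇒≱ i<k (s≤s⁻¹ k<1+i)
    }

  -- The last point of the increasing part is followed by a part of type ω*, which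
  -- has no least element.
  chain-end-no-successor : ∀ {σ i w} → suc i ≡ length σ → ¬ ((σ , i) ⋖ w)
  chain-end-no-successor {σ} {i} 1+i≡s (outer σ<τ , gap) =
    gap {σ , suc i} (inner (inj₁ (ℕ.n<1+n i , ℕ.≤-reflexive 1+i≡s))) (outer σ<τ)
  chain-end-no-successor {σ} {i} 1+i≡s (inner {b′ = j} i≺j , gap)
    with i<j ← block-above (ℕ.≤-reflexive 1+i≡s) i≺j =
    gap {σ , suc j} (inner (inj₁ (ℕ.m≤n⇒m≤1+n i<j , ℕ.≤-reflexive 1+i≡s)))
                    (inner (inj₂ (ℕ.n<1+n j , subst (_≤ j) 1+i≡s i<j)))

  predecessor : ∀ σ i → ∃[ w ] w ⋖ (σ , suc i)
  predecessor σ i with ℕ.<-≤-connex (suc i) (length σ)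
  ... | inj₁ 1+i<s = (σ , i) , chain-⋖ 1+i<s
  ... | inj₂ s≤1+i = (σ , suc (suc i)) , tail-⋖ s≤1+i

  no-predecessor⇒head : ∀ {σ i} → (∀ {w} → ¬ (w ⋖ (σ , i))) → i ≡ 0
  no-predecessor⇒head {i = zero}  _   = refl
  no-predecessor⇒head {σ} {suc i} ¬w⋖ = contradiction (proj₂ (predecessor σ i)) ¬w⋖

-- The map induced on points by a map on places; it keeps positions and indices.
lift : (ℕ → ℕ) → Pt → Pt
lift f ((n , q) , i) = (f n , q) , i

-- The point of the original order over which a point of the inflated order lies.
place : Pt → ℕ
place ((n , _) , _) = n

module _ (L : LO) (c : ℕ → ℕ) (L′ : LO) (c′ : ℕ → ℕ) (f : ℕ → ℕ) where
  private
    module X = Inflation L c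
    module Y = Inflation L′ c′

  lift-≺ : ∀ {x y} → (place x <[ L ] place y → f (place x) <[ L′ ] f (place y)) →
           c′ (f (place x)) ≡ c (place x) → x X.≺ y → lift f x Y.≺ lift f y
  lift-≺ mono _ (outer (outer m<n)) = outer (outer (mono m<n))
  lift-≺ _ _ (outer (inner p<q)) = outer (inner p<q)
  lift-≺ {(n , q) , i} {_ , j} _ colour (inner i<j) = inner (subst (λ a → Block (size a q) i j) (sym colour) i<j)

  lift-≼ : ∀ {x y} → (place x <[ L ] place y → f (place x) <[ L′ ] f (place y)) →
           c′ (f (place x)) ≡ c (place x) → x X.≼ y → lift f x Y.≼ lift f y
  lift-≼ mono colour (inj₁ x≺y)  = inj₁ (lift-≺ mono colour x≺y)
  lift-≼ mono colour (inj₂ refl) = inj₂ refl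

-- Embeddings and convex partitions

module _ (A B : Order) where
  private
    module A = TotalOrder A
    module B = TotalOrder B

  -- A strictly increasing map between total orders is an embedding.
  strict⇒embedding : (∀ x y → Dec (x A.≈ y)) → ∀ {f} →
                     (∀ {x y} → x A.≈ y → f x B.≈ f y) →
                     (∀ {x y} → Strict A x y → Strict B (f x) (f y)) →
                     IsEmbedding A B f
  strict⇒embedding _≈?_ {f} f-cong f-mono x y = mk⇔ to from
    where
    to : x A.≤ y → f x B.≤ f y
    to x≤y with x ≈? y
    ... | yes x≈y = B.reflexive (f-cong x≈y)
    ... | no  x≉y = proj₁ (f-mono (x≤y , x≉y))
    from : f x B.≤ f y → x A.≤ y
    from fx≤fy with A.total x y | y ≈? x
    ... | inj₁ x≤y | _       = x≤y
    ... | inj₂ _   | yes y≈x = A.reflexive (A.Eq.sym y≈x)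
    ... | inj₂ y≤x | no  y≉x with fy≤fx , fy≉fx ← f-mono (y≤x , y≉x) =
      contradiction (B.antisym fy≤fx fx≤fy) fy≉fx

  embedding⇒strict : ∀ {f} → IsEmbedding A B f → ∀ {x y} → Strict A x y → Strict B (f x) (f y)
  embedding⇒strict f-emb {x} {y} (x≤y , x≉y) =
    Equivalence.to (f-emb x y) x≤y ,
    λ fx≈fy → x≉y (A.antisym x≤y (Equivalence.from (f-emb y x) (B.reflexive (B.Eq.sym fx≈fy))))

parts-monotone : Classical → ∀ {K L} (P : ConvexPartition K L) → let open ConvexPartition P in
                 ∀ {k k′ x y} → part k x → part k′ y →
                 TotalOrder._≤_ L x y → TotalOrder._≤_ K k k′
parts-monotone em {K} {L} P {k} {k′} x∈k y∈k′ x≤y with K.total k k′ | em {P = k′ K.≈ k}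
  where module K = TotalOrder K
... | inj₁ k≤k′ | _        = k≤k′
... | inj₂ _    | yes k′≈k = TotalOrder.reflexive K (TotalOrder.Eq.sym K k′≈k)
... | inj₂ k′≤k | no  k′≉k with y≤x , y≉x ← Equivalence.to (ConvexPartition.ordered P k′ k) (k′≤k , k′≉k) y∈k′ x∈k =
  contradiction (TotalOrder.antisym L y≤x x≤y) y≉x

-- The suborder of K formed by the values of κ, coded again as a member of Lin.
module ValueOrder (em : Classical) (K : Lin) (κ : ℕ → ∣ ⟦ K ⟧ₗ ∣) where
  private
    module K = TotalOrder ⟦ K ⟧ₗ
    r = Lin.code K
    lab : ∣ ⟦ K ⟧ₗ ∣ → ℕ
    lab = label {r}

  -- The labels of the values of κ.
  S : Pred ℕ 0ℓ
  S t = ∃[ n ] lab (κ n) ≡ t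

  S? : Decidable S
  S? t = em

  -- A code M with an embedding e into K whose values are, up to equality of labels,
  -- the values of κ.
  Coded : Set
  Coded = Σ[ M ∈ Lin ] Σ[ e ∈ (∣ ⟦ M ⟧ₗ ∣ → ∣ ⟦ K ⟧ₗ ∣) ]
    IsEmbedding ⟦ M ⟧ₗ ⟦ K ⟧ₗ e × (∀ x → ∃[ n ] κ n K.≈ e x) × (∀ n → ∃[ x ] κ n K.≈ e x)

  -- Finitely many values: restrict the code of K to their labels.
  bounded : ∃[ b ] (∀ n → lab (κ n) < b) → Coded
  bounded (b , κ<b) = mkLin s (inj₁ record
    { supported    = λ {m} {n} mn → let S-m , S-n , _ = from mn in
                       diag S-m , diag S-n
    ; inhabited    = lab (κ 0) , diag (0 , refl)
    ; finite       = b , λ { (n , nn) → let (m , eq) , _ = from nn in subst (_< b) eq (κ<b m) }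
    ; isTotalOrder = record
      { isPartialOrder = record
        { isPreorder = record
          { isEquivalence = record { refl = refl ; sym = sym ; trans = trans }
          ; reflexive = λ { {x , p} refl → p }
          ; trans = λ {x} {y} {z} p q → into (in-S x) (in-S z)
                      (K.trans {e x} {e y} {e z} (e-≤ {x} {y} p) (e-≤ {y} {z} q))
          }
        ; antisym = λ {x} {y} p q → K.antisym {e x} {e y} (e-≤ {x} {y} p) (e-≤ {y} {x} q)
        }
      ; total = λ x y → [ inj₁ ∘ into (in-S x) (in-S y) , inj₂ ∘ into (in-S y) (in-S x) ]′
                          (K.total (e x) (e y))
      }
    }) , e , (λ x y → mk⇔ (e-≤ {x} {y}) (into (in-S x) (in-S y)))
       , (λ { (n , nn) → proj₁ (from nn) })
       , λ n → (lab (κ n) , diag (n , refl)) , refl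
    where
    s : Code
    s m n = ⌊ S? m ⌋ ∧ (⌊ S? n ⌋ ∧ r m n)
    into : ∀ {m n} → S m → S n → Le r m n → Le s m n
    into {m} {n} S-m S-n mn =
      Equivalence.from T-∧ (fromWitness {a? = S? m} S-m ,
      Equivalence.from T-∧ (fromWitness {a? = S? n} S-n , mn))
    from : ∀ {m n} → Le s m n → S m × S n × Le r m n
    from {m} {n} mn with T-m , T-nr ← Equivalence.to (T-∧ {⌊ S? m ⌋}) mn
                    with T-n , r-mn ← Equivalence.to (T-∧ {⌊ S? n ⌋}) T-nr =
      toWitness {a? = S? m} T-m , toWitness {a? = S? n} T-n , r-mn
    diag : ∀ {m} → S m → Le s m m
    diag S-m@(n , refl) = into S-m S-m (proj₂ (κ n))
    e : Dom s → ∣ ⟦ K ⟧ₗ ∣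
    e (n , nn) = n , proj₂ (proj₂ (from nn))
    in-S : (x : Dom s) → S (proj₁ x)
    in-S (n , nn) = proj₁ (from nn)
    e-≤ : {x y : Dom s} → Le s (proj₁ x) (proj₁ y) → Le r (proj₁ x) (proj₁ y)
    e-≤ = λ p → proj₂ (proj₂ (from p))

  -- Infinitely many values: pull the code of K back along the enumeration of their
  -- labels, since an infinite member of Lin has domain ℕ.
  unbounded : Unbounded S → Coded
  unbounded S-unbounded = mkLin s (inj₂ record
    { isTotalOrder = record
      { isPartialOrder = record
        { isPreorder = record
          { isEquivalence = isEquivalence
          ; reflexive = λ { {i} refl → K.refl {e i} }
          ; trans = λ {i} {j} {k} → K.trans {e i} {e j} {e k}
          }
        ; antisym = λ {i} {j} p q → nth-injective S? S-unbounded (K.antisym {e i} {e j} p q)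
        }
      ; total = λ i j → K.total (e i) (e j)
      }
    }) , (λ x → e (proj₁ x)) , (λ x y → mk⇔ id id)
       , (λ x → nth-∈ S? S-unbounded (proj₁ x))
       , λ n → let m , eq = nth-surjective S? S-unbounded (n , refl) in (m , K.refl {e m}) , sym eq
    where
    nth′ = nth S? S-unbounded
    s : Code
    s i j = r (nth′ i) (nth′ j)
    e : ℕ → ∣ ⟦ K ⟧ₗ ∣
    e i = nth′ i , in-dom (nth-∈ S? S-unbounded i)
      where
      in-dom : ∀ {t} → S t → Le r t t
      in-dom (n , refl) = proj₂ (κ n)

  valueOrder : Coded
  valueOrder with em {P = ∃[ b ] (∀ n → lab (κ n) < b)}
  ... | yes b = bounded b
  ... | no ¬b = unbounded λ n → decidable-stable em λ ¬large →
    ¬b (n , λ m → ℕ.≰⇒> λ n≤κm → ¬large (lab (κ m) , n≤κm , m , refl))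

Dom-≡ : ∀ {r} {x y : Dom r} → label {r} x ≡ label {r} y → x ≡ y
Dom-≡ {r} {n , p} {_ , q} refl = cong (n ,_) (T-irrelevant p q)

-- The partition of L into the classes of points equally labelled by a monotone κ,
-- indexed by a suborder N of K that consists of the values of κ.
module Classes
  (L : LO) (N K : Order) (κ : ℕ → ∣ K ∣) (κ-mono : ∀ {m n} → m <[ L ] n → TotalOrder._≤_ K (κ m) (κ n))
  (e : ∣ N ∣ → ∣ K ∣) (e-emb : IsEmbedding N K e)
  (e-hits : ∀ i → ∃[ n ] TotalOrder._≈_ K (κ n) (e i))
  (hit : ∀ n → ∃[ i ] TotalOrder._≈_ K (κ n) (e i))
  where

  private
    module K = TotalOrder K
    module N = TotalOrder N
    module 𝕃 = IsStrictTotalOrder (<[]-isStrictTotalOrder L)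

  e-reflects-≈ : ∀ {i j} → e i K.≈ e j → i N.≈ j
  e-reflects-≈ {i} {j} ei≈ej = N.antisym (Equivalence.from (e-emb i j) (K.reflexive ei≈ej))
                                         (Equivalence.from (e-emb j i) (K.reflexive (K.Eq.sym ei≈ej)))

  <⇒classes-< : ∀ {i j} → Strict N i j → ∀ {m n} → κ m K.≈ e i → κ n K.≈ e j → m <[ L ] n
  <⇒classes-< i<j {m} {n} m∈i n∈j
    with ei≤ej , ei≉ej ← embedding⇒strict N K e-emb i<j
    with 𝕃.compare m n
  ... | tri< m<n _ _  = m<n
  ... | tri≈ _ refl _ = contradiction (K.Eq.trans (K.Eq.sym m∈i) n∈j) ei≉ej
  ... | tri> _ _ n<m  = contradiction (K.antisym ei≤ej (K.trans (K.reflexive (K.Eq.sym n∈j))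
                          (K.trans (κ-mono n<m) (K.reflexive m∈i)))) ei≉ej

  classes-<⇒< : ∀ {i j} → (∀ {m n} → κ m K.≈ e i → κ n K.≈ e j → m <[ L ] n) → Strict N i j
  classes-<⇒< {i} {j} below with m , m∈i ← e-hits i | n , n∈j ← e-hits j =
    Equivalence.from (e-emb i j) (K.trans (K.reflexive (K.Eq.sym m∈i))
      (K.trans (κ-mono (below m∈i n∈j)) (K.reflexive n∈j))) ,
    λ i≈j → 𝕃.irrefl refl (below (K.Eq.trans n∈j (K.antisym
      (Equivalence.to (e-emb j i) (N.reflexive (N.Eq.sym i≈j)))
      (Equivalence.to (e-emb i j) (N.reflexive i≈j)))) n∈j)

  classes : ConvexPartition N ⟦ L ⟧
  classes = record
    { part     = λ i n → κ n K.≈ e i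
    ; nonempty = e-hits
    ; covers   = hit
    ; disjoint = λ p q → e-reflects-≈ (K.Eq.trans (K.Eq.sym p) q)
    ; ordered  = λ i j → mk⇔ (λ i<j {m} {n} → <⇒classes-< i<j {m} {n})
                             (λ below → classes-<⇒< (λ {m} {n} → below {m} {n}))
    }

  module _ (L′ : LO) {f : ℕ → ℕ}
    (fill : ∀ {m n t} → κ m K.≈ κ n → f m <[ L′ ] t → t <[ L′ ] f n → ∃[ k ] κ k K.≈ κ m × f k ≡ t)
    where

    fill-≤ : ∀ {i m n t} → κ m K.≈ e i → κ n K.≈ e i →
             TotalOrder._≤_ ⟦ L′ ⟧ (f m) t → TotalOrder._≤_ ⟦ L′ ⟧ t (f n) →
             Dec (f m ≡ t) → Dec (t ≡ f n) → ∃[ k ] κ k K.≈ e i × f k ≡ t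
    fill-≤ m∈i n∈i m≤t t≤n (yes fm≡t) _          = _ , m∈i , fm≡t
    fill-≤ m∈i n∈i m≤t t≤n (no _)     (yes t≡fn) = _ , n∈i , sym t≡fn
    fill-≤ m∈i n∈i m≤t t≤n (no fm≢t)  (no t≢fn)
      with k , k~m , fk≡t ← fill (K.Eq.trans m∈i (K.Eq.sym n∈i)) (m≤t , fm≢t) (t≤n , t≢fn) =
      k , K.Eq.trans k~m m∈i , fk≡t

    classes-convex : ∀ i → IsConvex ⟦ L′ ⟧ (Image ⟦ L ⟧ ⟦ L′ ⟧ f (ConvexPartition.part classes i))
    classes-convex i {y = t} m≤t t≤n (m , m∈i , refl) (n , n∈i , refl) =
      fill-≤ m∈i n∈i m≤t t≤n (f m ℕ.≟ t) (t ℕ.≟ f n)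

-- Let f be strictly increasing and κ a monotone labelling of L by K such that f
-- maps each class of equally labelled points onto a convex set.  Then f is a
-- witness: its pieces are these classes, indexed by the values of κ.
labelling⇒witnesses : Classical → ∀ {𝓛} → DownwardClosed 𝓛 → ∀ {L L′ K f} → 𝓛 K →
  (∀ {m n} → m <[ L ] n → f m <[ L′ ] f n) →
  (κ : ℕ → ∣ ⟦ K ⟧ₗ ∣) (let module K = TotalOrder ⟦ K ⟧ₗ) →
  (∀ {m n} → m <[ L ] n → κ m K.≤ κ n) →
  (∀ {m n t} → κ m K.≈ κ n → f m <[ L′ ] t → t <[ L′ ] f n → ∃[ k ] κ k K.≈ κ m × f k ≡ t) →
  Witnesses 𝓛 L L′ f
labelling⇒witnesses em downward {L} {L′} {K} {f} K∈𝓛 f-mono κ κ-mono fill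
  with N , e , e-emb , e-hits , hit ← ValueOrder.valueOrder em K κ = record
  { embedding = strict⇒embedding ⟦ L ⟧ ⟦ L′ ⟧ ℕ._≟_ (cong f) f-mono
  ; K         = N
  ; K∈𝓛       = downward {N} {K} (e , e-emb) K∈𝓛
  ; partition = C.classes
  ; convex    = C.classes-convex L′ (λ {m} {n} → fill {m} {n})
  }
  where module C = Classes L ⟦ N ⟧ₗ ⟦ K ⟧ₗ κ κ-mono e e-emb e-hits hit

-- Continuous maps are Borel

-- Continuity, in terms of the basic neighbourhoods of a point and of its image.
IsContinuous : (X Y : Space) → (Point X → Point Y) → Set
IsContinuous X Y φ = ∀ x n → ∃[ m ] (∀ y → Space.Agree X m x y → Space.Agree Y n (φ x) (φ y))

continuous⇒borel : ∀ {X Y φ} → IsContinuous X Y φ → IsBorelMap X Y φ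
continuous⇒borel {φ = φ} φ-cont (isOpen {U} U-open) = isOpen λ {x} φx∈U →
  let n , near = U-open φx∈U
      m , agree = φ-cont x n
  in m , λ y xy → near (φ y) (agree y xy)
continuous⇒borel φ-cont (complement b)       = complement (continuous⇒borel φ-cont b)
continuous⇒borel φ-cont (union bs)           = union λ n → continuous⇒borel φ-cont (bs n)
continuous⇒borel φ-cont (respects (⊆ , ⊇) b) = respects (⊆ , ⊇) (continuous⇒borel φ-cont b)

strict-bound : ∀ (h : ℕ → ℕ) n → ∃[ m ] (∀ {i} → i < n → h i < m)
strict-bound h zero    = 0 , λ ()
strict-bound h (suc n) with m , below ← strict-bound h n = suc (h n) ⊔ m , λ {i} i≤n →
  [ (λ i<n → ℕ.<-≤-trans (below i<n) (ℕ.m≤n⊔m (suc (h n)) m))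
  , (λ { refl → ℕ.m≤m⊔n (suc (h n)) m })
  ]′ (ℕ.m≤n⇒m<n∨m≡n (s≤s⁻¹ i≤n))

-- Recovering a coloured embedding

ℚ-strict⇒< : ∀ {x y} → Strict ℚ-order x y → x ℚ.< y
ℚ-strict⇒< (x≤y , x≢y) = ℚ.≰⇒> λ y≤x → x≢y (ℚ.≤-antisym x≤y y≤x)

-- G is a strictly increasing map between two inflated orders, and κ is the
-- monotone labelling of the points by the pieces of a convex partition.  The
-- hypothesis fill says that each piece has a convex image.
module Recover
  (em : Classical) (L : LO) (c : ℕ → ℕ) (L′ : LO) (c′ : ℕ → ℕ)
  (K : Order) (ℚ⋠K : ¬ (ℚ-order ⪯ K))
  (G : Pt → Pt) (G-mono : ∀ {x y} → Inflation._≺_ L c x y → Inflation._≺_ L′ c′ (G x) (G y))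
  (κ : Pt → ∣ K ∣) (κ-mono : ∀ {x y} → Inflation._≼_ L c x y → TotalOrder._≤_ K (κ x) (κ y))
  (fill : ∀ x y z → TotalOrder._≈_ K (κ x) (κ z) →
          Inflation._≺_ L′ c′ (G x) y → Inflation._≺_ L′ c′ y (G z) → ∃[ w ] G w ≡ y)
  where

  private
    module X = Inflation L c
    module Y = Inflation L′ c′
    module K = TotalOrder K

  G-reflects : ∀ {x y} → G x Y.≺ G y → x X.≺ y
  G-reflects {x} {y} Gx≺Gy with X.≺.compare x y
  ... | tri< x≺y _ _  = x≺y
  ... | tri≈ _ refl _ = contradiction Gx≺Gy (Y.≺.irrefl refl)
  ... | tri> _ _ y≺x  = contradiction (G-mono y≺x) (Y.≺.asym Gx≺Gy)

  -- Pieces are convex.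
  between : ∀ {x y z} → x X.≼ y → y X.≼ z → κ x K.≈ κ z → κ y K.≈ κ x
  between x≼y y≼z x~z =
    K.antisym (K.trans (κ-mono y≼z) (K.reflexive (K.Eq.sym x~z))) (κ-mono x≼y)

  -- A point between G x and G y would be the image of a point between x and y.
  G-⋖ : ∀ {x y} → κ x K.≈ κ y → x X.⋖ y → G x Y.⋖ G y
  G-⋖ {x} {y} x~y (x≺y , gap) = G-mono x≺y , G-gap
    where
    G-gap : ∀ {v} → G x Y.≺ v → ¬ v Y.≺ G y
    G-gap p q with w , refl ← fill _ _ _ x~y p q = gap (G-reflects p) (G-reflects q)

  G-⋖-reflects : ∀ {x y} → G x Y.⋖ G y → x X.⋖ y
  G-⋖-reflects (p , gap) = G-reflects p , λ q r → gap (G-mono q) (G-mono r)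

  -- The point z ensures that an immediate predecessor of G x lies between images
  -- of points of one piece.
  reflect-predecessor : ∀ {u x z} → z X.≺ x → κ z K.≈ κ x → u Y.⋖ G x → ∃[ w ] w X.⋖ x
  reflect-predecessor {u} {x} {z} z≺x z~x u⋖Gx@(u≺Gx , gap) with Y.≺.compare (G z) u
  ... | tri< Gz≺u _ _ with w , refl ← fill _ _ _ z~x Gz≺u u≺Gx = w , G-⋖-reflects u⋖Gx
  ... | tri≈ _ refl _ = z , G-⋖-reflects u⋖Gx
  ... | tri> _ _ u≺Gz = contradiction (G-mono z≺x) (gap u≺Gz)

  reflect-successor : ∀ {u x z} → x X.≺ z → κ x K.≈ κ z → G x Y.⋖ u → ∃[ w ] x X.⋖ w
  reflect-successor {u} {x} {z} x≺z x~z Gx⋖u@(Gx≺u , gap) with Y.≺.compare u (G z)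
  ... | tri< u≺Gz _ _ with w , refl ← fill _ _ _ x~z Gx≺u u≺Gz = w , G-⋖-reflects Gx⋖u
  ... | tri≈ _ refl _ = z , G-⋖-reflects Gx⋖u
  ... | tri> _ _ Gz≺u = contradiction Gz≺u (gap (G-mono x≺z))

  -- A site is good if its block and some earlier point lie in one piece.  As the
  -- index `X.length σ` is the greatest element of the block, it suffices to compare
  -- it with the earlier point.
  Good : Site → Set
  Good σ = ∃[ z ] z X.≺ (σ , 0) × κ z K.≈ κ (σ , X.length σ)

  good-link : ∀ {σ} (good : Good σ) i → κ (σ , i) K.≈ κ (proj₁ good)
  good-link {σ} (z , z≺σ , z~σ) i =
    between (X.≼.trans (inj₁ z≺σ) (X.head-least σ i)) (X.last-greatest σ i) z~σ

  block-linked : ∀ {σ} → Good σ → ∀ i j → κ (σ , i) K.≈ κ (σ , j)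
  block-linked good i j = K.Eq.trans (good-link good i) (K.Eq.sym (good-link good j))

  -- The head of the block at (n , q) is sent to the head of the block at the same
  -- position over a point of the same colour.
  record Recognised (n : ℕ) (q : Position) : Set where
    constructor recognised
    field
      target : ℕ
      colour : c′ target ≡ c n
      image  : G ((n , q) , 0) ≡ ((target , q) , 0)

  good-head : ∀ {σ} → Good σ → ∃[ τ ] G (σ , 0) ≡ (τ , 0)
  good-head {σ} good@(z , z≺σ , _) with G (σ , 0) in eq
  ... | (τ , i) with Y.no-predecessor⇒head {τ} {i} (λ {w} w⋖ →
                     X.head-no-predecessor (proj₂ (reflect-predecessor z≺σ (K.Eq.sym (good-link good 0))
                       (subst (w Y.⋖_) (sym eq) w⋖))))
  ...   | refl = τ , refl

  good-chain : ∀ {σ τ} → Good σ → G (σ , 0) ≡ (τ , 0) →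
               ∀ i → i < X.length σ → i < Y.length τ → G (σ , i) ≡ (τ , i)
  good-chain         good eq zero    _   _    = eq
  good-chain {σ} {τ} good eq (suc i) i<s i<s′ = Y.⋖-unique
    (subst (Y._⋖ G (σ , suc i)) (good-chain good eq i (ℕ.<⇒≤ i<s) (ℕ.<⇒≤ i<s′))
      (G-⋖ (block-linked good i (suc i)) (X.chain-⋖ i<s)))
    (Y.chain-⋖ i<s′)

  -- If one increasing part were shorter than the other, its last point would have
  -- an immediate successor.
  good-length : ∀ {σ τ} → Good σ → G (σ , 0) ≡ (τ , 0) → X.length σ ≡ Y.length τ
  good-length {σ@(n , p)} {τ@(m , q)} good eq with ℕ.<-cmp (X.length σ) (Y.length τ)
  ... | tri≈ _ s≡s′ _ = s≡s′
  ... | tri< s<s′ _ _ = ⊥-elim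
    (X.chain-end-no-successor refl (proj₂ (reflect-successor {x = σ , i} (inner (inj₁ (ℕ.n<1+n i , ℕ.n<1+n i)))
      (block-linked good i (suc i))
      (subst (Y._⋖ (τ , suc i)) (sym (good-chain good eq i (ℕ.n<1+n i) (ℕ.<⇒≤ s<s′))) (Y.chain-⋖ s<s′)))))
    where
    i = pair (c n) (position-index p)
  ... | tri> _ _ s′<s = ⊥-elim
    (Y.chain-end-no-successor refl
      (subst (Y._⋖ G (σ , suc i)) (good-chain good eq i (ℕ.<⇒≤ s′<s) (ℕ.n<1+n i))
        (G-⋖ (block-linked good i (suc i)) (X.chain-⋖ s′<s))))
    where
    i = pair (c′ m) (position-index q)

  recognise : ∀ {n q} → Good (n , q) → Recognised n q
  recognise {n} {q} good
    with (m , r) , eq ← good-head good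
    with colour , refl ← size-injective {c n} {c′ m} {q} {r} (good-length good eq) =
    recognised m (sym colour) eq

  -- The sites over n at the positions in copy j of ℚ.
  module _ (n j : ℕ) where

    row : ℚ → Pt
    row x = (n , j , x) , 0

    -- If no site of the row is good, then κ is strictly increasing on the heads of
    -- its blocks: two heads in one piece would make every site between them good.
    good-in-row : ∃[ x ] Good (n , j , x)
    good-in-row = decidable-stable em λ none → ℚ⋠K
      (κ ∘ row , strict⇒embedding ℚ-order K ℚ._≟_ (λ { refl → K.Eq.refl })
        λ { {x} {y} x<y →
            κ-mono (inj₁ (outer (inner (inner (ℚ-strict⇒< x<y))))) ,
            λ x~y → let z , x<z , z<y = ℚ.<-dense (ℚ-strict⇒< x<y)
                    in none (z , row x , outer (inner (inner x<z)) ,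
                             K.Eq.sym (between (inj₁ (outer (inner (inner x<z)))) (inj₁ (outer (inner (inner z<y)))) x~y)) })

  open Recognised

  -- If the targets agreed, a good position r of n below p and q would have the same
  -- target, since its image lies between the other two; but then p would be below r.
  targets-monotone : ∀ {m n p q} → m <[ L ] n →
                     (g : Recognised m p) (h : Recognised n q) → target g <[ L′ ] target h
  targets-monotone {m} {n} {p@(j , _)} {q@(k , _)} m<n g h =
    [ id , (λ { (g≡h , _) → contradiction low<p (Pos.asym (p<low g≡h)) }) ]′ (Y.head-compare g≺h)
    where
    -- The order on the first components is reversed: suc (j ⊔ k) is below j and k.
    x = proj₁ (good-in-row n (suc (j ⊔ k)))
    r : Position
    r = suc (j ⊔ k) , x
    low : Recognised n r
    low = recognise (proj₂ (good-in-row n (suc (j ⊔ k))))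
    g≺h : ((target g , p) , 0) Y.≺ ((target h , q) , 0)
    g≺h = subst₂ Y._≺_ (image g) (image h) (G-mono (outer (outer m<n)))
    g≺low : ((target g , p) , 0) Y.≺ ((target low , r) , 0)
    g≺low = subst₂ Y._≺_ (image g) (image low) (G-mono (outer (outer m<n)))
    low≺h : ((target low , r) , 0) Y.≺ ((target h , q) , 0)
    low≺h = subst₂ Y._≺_ (image low) (image h) (G-mono (outer (inner (outer (s≤s (ℕ.m≤n⊔m j k))))))
    low<p : r <ₚ p
    low<p = outer (s≤s (ℕ.m≤m⊔n j k))
    p<low : target g ≡ target h → p <ₚ r
    p<low g≡h = proj₁ (Y.head-squeeze g≺low (subst (λ t → ((target low , r) , 0) Y.≺ ((t , q) , 0)) (sym g≡h) low≺h))

  -- An immediate predecessor of the preimage of a head would lie in the same piece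
  -- and be sent to an immediate predecessor of that head.
  preimage-is-head : ∀ {x z ρ k r i} → x X.≺ ((k , r) , i) → ((k , r) , i) X.≺ z → κ x K.≈ κ z →
                     G ((k , r) , i) ≡ (ρ , 0) → i ≡ 0
  preimage-is-head {x} {z} {ρ} {k} {r} {i} x≺w w≺z x~z eq = X.no-predecessor⇒head λ {u} u⋖w →
    Y.head-no-predecessor (subst (G u Y.⋖_) eq
      (G-⋖ (K.Eq.trans (between (x≼u u⋖w) (inj₁ (X.≺.trans (proj₁ u⋖w) w≺z)) x~z)
                       (K.Eq.sym (between (inj₁ x≺w) (inj₁ w≺z) x~z))) u⋖w))
    where
    x≼u : ∀ {u} → u X.⋖ ((k , r) , i) → x X.≼ u
    x≼u {u} (_ , gap) with X.≼.total x u
    ... | inj₁ x≼u         = x≼u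
    ... | inj₂ (inj₂ refl) = inj₂ refl
    ... | inj₂ (inj₁ u≺x)  = contradiction x≺w (gap u≺x)

  position-preserved : ∀ {k q t r} → Good (k , q) → G ((k , q) , 0) ≡ ((t , r) , 0) → q ≡ r
  position-preserved good eq =
    cong (proj₂ ∘ proj₁) (trans (sym (image (recognise good))) eq)

  -- Every head between the images of two heads of one piece is the image of a head
  -- at the same position, whose block is good as it lies between those two heads.
  fill-head : ∀ {σ τ t r} → κ (σ , 0) K.≈ κ (τ , 0) →
              G (σ , 0) Y.≺ ((t , r) , 0) → ((t , r) , 0) Y.≺ G (τ , 0) →
              ∃[ k ] (σ , 0) X.≺ ((k , r) , 0) × ((k , r) , 0) X.≺ (τ , 0) ×
                     Good (k , r) × G ((k , r) , 0) ≡ ((t , r) , 0)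
  fill-head {σ} {τ} {t} {r} σ~τ σ≺t t≺τ with (w@((k , r′) , i) , eq) ← fill _ _ _ σ~τ σ≺t t≺τ =
    conclude (preimage-is-head σ≺w w≺τ σ~τ eq) σ≺w w≺τ eq
    where
    σ≺w : (σ , 0) X.≺ w
    σ≺w = G-reflects (subst (G (σ , 0) Y.≺_) (sym eq) σ≺t)
    w≺τ : w X.≺ (τ , 0)
    w≺τ = G-reflects (subst (Y._≺ G (τ , 0)) (sym eq) t≺τ)
    conclude : ∀ {r′ i} → i ≡ 0 → (σ , 0) X.≺ ((k , r′) , i) → ((k , r′) , i) X.≺ (τ , 0) →
               G ((k , r′) , i) ≡ ((t , r) , 0) →
               ∃[ k ] (σ , 0) X.≺ ((k , r) , 0) × ((k , r) , 0) X.≺ (τ , 0) ×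
                      Good (k , r) × G ((k , r) , 0) ≡ ((t , r) , 0)
    conclude {r′} refl σ≺w w≺τ eq = settle (position-preserved good eq) good σ≺w w≺τ eq
      where
      good : Good (k , r′)
      good = (σ , 0) , σ≺w ,
             K.Eq.sym (between (X.≼.trans (inj₁ σ≺w) (X.head-least _ _)) (inj₁ (X.<ₛ-last w≺τ)) σ~τ)
      settle : ∀ {r′} → r′ ≡ r → Good (k , r′) → (σ , 0) X.≺ ((k , r′) , 0) →
               ((k , r′) , 0) X.≺ (τ , 0) → G ((k , r′) , 0) ≡ ((t , r) , 0) →
               ∃[ k ] (σ , 0) X.≺ ((k , r) , 0) × ((k , r) , 0) X.≺ (τ , 0) ×
                      Good (k , r) × G ((k , r) , 0) ≡ ((t , r) , 0)
      settle refl good σ≺w w≺τ eq = k , σ≺w , w≺τ , good , eq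

  -- If the targets differed, the head at position q over the target of g would be
  -- the image of a head at position q lying strictly between p and q over n.
  target-constant : ∀ {n p q} (g : Recognised n p) (h : Recognised n q) → p <ₚ q →
                    κ ((n , p) , 0) K.≈ κ ((n , q) , 0) → target g ≡ target h
  target-constant {n} {p} {q} g h p<q g~h = [ ⊥-elim ∘ jump , proj₁ ]′
    (Y.head-compare (subst₂ Y._≺_ (image g) (image h) (G-mono (outer (inner p<q)))))
    where
    jump : ¬ (target g <[ L′ ] target h)
    jump g<h with k , n≺k , k≺n , _ ← fill-head g~h
      (subst (Y._≺ ((target g , q) , 0)) (sym (image g)) (outer (inner p<q)))
      (subst (((target g , q) , 0) Y.≺_) (sym (image h)) (outer (outer g<h))) =
      Pos.irrefl refl (proj₂ (X.head-squeeze n≺k k≺n))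

  head-order : ∀ {m n p q} → ((m , p) , 0) X.≺ ((n , q) , 0) → m ≡ n ⊎ m <[ L ] n
  head-order m≺n = [ inj₂ , inj₁ ∘ proj₁ ]′ (X.head-compare m≺n)

  -- Copy 0 of ℚ is an arbitrary choice.
  choice : ∀ n → ∃ (Recognised n)
  choice n = (0 , proj₁ (good-in-row n 0)) , recognise (proj₂ (good-in-row n 0))

  -- The argument uses of a choice only that its positions are recognised.
  module Choice (chosen : ℕ → Position) (chosen-recognised : ∀ n → Recognised n (chosen n)) where

    f : ℕ → ℕ
    f n = target (chosen-recognised n)

    f-colour : ∀ n → c′ (f n) ≡ c n
    f-colour n = colour (chosen-recognised n)

    f-mono : ∀ {m n} → m <[ L ] n → f m <[ L′ ] f n
    f-mono m<n = targets-monotone m<n (chosen-recognised _) (chosen-recognised _)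

    -- The piece of the chosen head over n.
    κ₀ : ℕ → ∣ K ∣
    κ₀ n = κ ((n , chosen n) , 0)

    κ₀-mono : ∀ {m n} → m <[ L ] n → κ₀ m K.≤ κ₀ n
    κ₀-mono m<n = κ-mono (inj₁ (outer (outer m<n)))

    κ₀-mono′ : ∀ {m n} → m ≡ n ⊎ m <[ L ] n → κ₀ m K.≤ κ₀ n
    κ₀-mono′ (inj₁ refl) = K.refl
    κ₀-mono′ (inj₂ m<n)  = κ₀-mono m<n

    -- Any position may serve for the head over t; that of m is taken.
    f-fill : ∀ {m n t} → κ₀ m K.≈ κ₀ n → f m <[ L′ ] t → t <[ L′ ] f n → ∃[ k ] κ₀ k K.≈ κ₀ m × f k ≡ t
    f-fill {m} {n} {t} m~n m<t t<n
      with k , m≺k , k≺n , good , eq ← fill-head {r = chosen m} m~n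
        (subst (Y._≺ ((t , chosen m) , 0)) (sym (image (chosen-recognised m))) (outer (outer m<t)))
        (subst (((t , chosen m) , 0) Y.≺_) (sym (image (chosen-recognised n))) (outer (outer t<n))) =
      k , k~m , same (Pos.compare (chosen k) (chosen m))
      where
      k~m : κ₀ k K.≈ κ₀ m
      k~m = K.antisym (K.trans (κ₀-mono′ (head-order k≺n)) (K.reflexive (K.Eq.sym m~n)))
                      (κ₀-mono′ (head-order m≺k))
      link : κ ((k , chosen m) , 0) K.≈ κ₀ k
      link = K.Eq.trans (between (inj₁ m≺k) (inj₁ k≺n) m~n) (K.Eq.sym k~m)
      rec : Recognised k (chosen m)
      rec = recognise good
      rec-target : target rec ≡ t
      rec-target = cong place (trans (sym (image rec)) eq)
      same : Tri (chosen k <ₚ chosen m) (chosen k ≡ chosen m) (chosen m <ₚ chosen k) → f k ≡ t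
      same (tri< lt _ _) = trans (target-constant (chosen-recognised k) rec lt (K.Eq.sym link)) rec-target
      same (tri> _ _ gt) = trans (sym (target-constant rec (chosen-recognised k) gt link)) rec-target
      same (tri≈ _ e _)  = cong place
        (trans (sym (image (chosen-recognised k))) (trans (cong (λ q → G ((k , q) , 0)) e) eq))

-- The reductions

module Inflate (em : Classical) where

  -- A numbering of the points, which does not depend on L and c.
  points : ℕ ↔ Pt
  points = ℕ↔ em Pt-index Pt-index-injective Pt-index-unbounded

  abstract
    dec : ℕ → Pt
    dec = Inverse.to points

    enc : Pt → ℕ
    enc = Inverse.from points

    dec-enc : ∀ x → dec (enc x) ≡ x
    dec-enc = Inverse.strictlyInverseˡ points

    enc-dec : ∀ t → enc (dec t) ≡ t
    enc-dec = Inverse.strictlyInverseʳ points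

  dec-injective : Injective _≡_ _≡_ dec
  dec-injective {t} {u} eq = trans (sym (enc-dec t)) (trans (cong enc eq) (enc-dec u))

  -- The order ≺ on points, transported to ℕ.
  inflate : LOℕ → LO
  inflate (L , c) = mkLO code record
    { isTotalOrder = record
      { isPartialOrder = record
        { isPreorder = record
          { isEquivalence = isEquivalence
          ; reflexive     = λ { refl → fromWitness (inj₂ refl) }
          ; trans         = λ p q → fromWitness (X.≼.trans (toWitness p) (toWitness q))
          }
        ; antisym = λ p q → dec-injective (X.≼.antisym (toWitness p) (toWitness q))
        }
      ; total = λ t u → [ inj₁ ∘ fromWitness , inj₂ ∘ fromWitness ]′ (X.≼.total (dec t) (dec u))
      }
    }
    where
    module X = Inflation L c
    code : Code
    code t u = ⌊ dec t X.≼? dec u ⌋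

  -- The comparison of two numbers depends only on the order and the colours of the
  -- places of the two points that they code.
  inflate-continuous : IsContinuous LOℕ-space LO-space inflate
  inflate-continuous (L , c) n with m , place< ← strict-bound (place ∘ dec) n =
    m , λ (L′ , c′) (L~L′ , c~c′) {i} {j} i<n j<n →
      let module X = Inflation L c
          module Y = Inflation L′ c′
          transfer : ∀ {k l} → k < m → l < m → k <[ L ] l → k <[ L′ ] l
          transfer k<m l<m (k≤l , k≢l) = subst T (L~L′ k<m l<m) k≤l , k≢l
          transfer′ : ∀ {k l} → k < m → l < m → k <[ L′ ] l → k <[ L ] l
          transfer′ k<m l<m (k≤l , k≢l) = subst T (sym (L~L′ k<m l<m)) k≤l , k≢l
          p = place< i<n
          q = place< j<n
      in trans (isYes≗does (dec i X.≼? dec j))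
        (trans (does-⇔ (mk⇔ (lift-≼ L c L′ c′ id (transfer p q) (sym (c~c′ p)))
                            (lift-≼ L′ c′ L c id (transfer′ p q) (c~c′ p)))
                       (dec i X.≼? dec j) (dec i Y.≼? dec j))
               (sym (isYes≗does (dec i Y.≼? dec j))))

  module _ (L : LO) (c : ℕ → ℕ) where
    private module X = Inflation L c

    inflate-≤⇒ : ∀ {t u} → Le (LO.code (inflate (L , c))) t u → dec t X.≼ dec u
    inflate-≤⇒ = toWitness

    inflate-≤⇐ : ∀ {t u} → dec t X.≼ dec u → Le (LO.code (inflate (L , c))) t u
    inflate-≤⇐ = fromWitness

    inflate-<⇒ : ∀ {t u} → t <[ inflate (L , c) ] u → dec t X.≺ dec u
    inflate-<⇒ (t≤u , t≢u) = [ id , (λ eq → contradiction (dec-injective eq) t≢u) ]′ (toWitness t≤u)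

    inflate-<⇐ : ∀ {t u} → dec t X.≺ dec u → t <[ inflate (L , c) ] u
    inflate-<⇐ t≺u = fromWitness (inj₁ t≺u) , λ { refl → X.≺.irrefl refl t≺u }

  module _ (𝓛 : Class) (L : LO) (c : ℕ → ℕ) (L′ : LO) (c′ : ℕ → ℕ) where
    private
      module X = Inflation L c
      module Y = Inflation L′ c′
      M = inflate (L , c)
      M′ = inflate (L′ , c′)

    -- The pieces are the sets of points over the pieces of the given partition.
    inflate-preserves : ⊴LOℕ 𝓛 (L , c) (L′ , c′) → ⊴LO 𝓛 M M′
    inflate-preserves (f , wit , colour) = enc ∘ lift f ∘ dec , record
      { embedding = strict⇒embedding ⟦ M ⟧ ⟦ M′ ⟧ ℕ._≟_ (cong _) λ {t} {u} t<u →
          inflate-<⇐ L′ c′ (subst₂ Y._≺_ (sym (dec-enc _)) (sym (dec-enc _))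
            (lift-≺ L c L′ c′ f f-mono (colour (place (dec t))) (inflate-<⇒ L c t<u)))
      ; K         = W.K
      ; K∈𝓛       = W.K∈𝓛
      ; partition = record
        { part     = λ k t → P.part k (place (dec t))
        ; nonempty = λ k → let n , n∈k = P.nonempty k in
                       head n , subst (P.part k) (sym (place-head n)) n∈k
        ; covers   = λ t → P.covers (place (dec t))
        ; disjoint = P.disjoint
        ; ordered  = λ k k′ → mk⇔
            (λ k<k′ {t} {u} t∈k u∈k′ → inflate-<⇐ L c
              (outer (outer (Equivalence.to (P.ordered k k′) k<k′ t∈k u∈k′))))
            (λ below → Equivalence.from (P.ordered k k′) λ {m} {n} m∈k n∈k′ →
              heads-< (inflate-<⇒ L c (below {head m} {head n}
                (subst (P.part k) (sym (place-head m)) m∈k)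
                (subst (P.part k′) (sym (place-head n)) n∈k′))))
        }
      ; convex    = λ { k {y = y} t≤y y≤u (t , t∈k , refl) (u , u∈k , refl) →
          let n , n∈k , fn≡y = W.convex k
                (place-≤ (subst (Y._≼ dec y) (dec-enc _) (inflate-≤⇒ L′ c′ t≤y)))
                (place-≤ (subst (dec y Y.≼_) (dec-enc _) (inflate-≤⇒ L′ c′ y≤u)))
                (_ , t∈k , refl) (_ , u∈k , refl)
              w = (n , proj₂ (proj₁ (dec y))) , proj₂ (dec y)
          in enc w , subst (P.part k) (cong place (sym (dec-enc w))) n∈k ,
             trans (cong (enc ∘ lift f) (dec-enc w))
               (trans (cong (λ m → enc ((m , proj₂ (proj₁ (dec y))) , proj₂ (dec y))) fn≡y) (enc-dec y)) }
      }
      where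
      module W = Witnesses wit
      module P = ConvexPartition W.partition
      f-mono : ∀ {m n} → m <[ L ] n → f m <[ L′ ] f n
      f-mono = embedding⇒strict ⟦ L ⟧ ⟦ L′ ⟧ W.embedding
      head : ℕ → ℕ
      head n = enc ((n , origin) , 0)
      place-head : ∀ n → place (dec (head n)) ≡ n
      place-head n = cong place (dec-enc _)
      heads-< : ∀ {m n} → dec (head m) X.≺ dec (head n) → m <[ L ] n
      heads-< p = [ id , (λ (_ , q) → contradiction q (Pos.irrefl refl)) ]′
        (X.head-compare (subst₂ X._≺_ (dec-enc _) (dec-enc _) p))
      place-≤ : ∀ {x y} → x Y.≼ y → TotalOrder._≤_ ⟦ L′ ⟧ (place x) (place y)
      place-≤ (inj₁ (outer (outer m<n))) = proj₁ m<n
      place-≤ (inj₁ (outer (inner _)))   = TotalOrder.refl ⟦ L′ ⟧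
      place-≤ (inj₁ (inner _))           = TotalOrder.refl ⟦ L′ ⟧
      place-≤ (inj₂ refl)                = TotalOrder.refl ⟦ L′ ⟧

    -- The points are labelled by the pieces of the given partition.
    inflate-reflects : 𝓛 ⊆ Scat → DownwardClosed 𝓛 → ⊴LO 𝓛 M M′ → ⊴LOℕ 𝓛 (L , c) (L′ , c′)
    inflate-reflects scattered downward (g , wit) =
      f , labelling⇒witnesses em downward W.K∈𝓛 f-mono κ₀ κ₀-mono f-fill , f-colour
      where
      module W = Witnesses wit
      module P = ConvexPartition W.partition
      module K = TotalOrder ⟦ W.K ⟧ₗ
      G : Pt → Pt
      G = dec ∘ g ∘ enc
      g-strict : ∀ {t u} → t <[ M ] u → g t <[ M′ ] g u
      g-strict = embedding⇒strict ⟦ M ⟧ ⟦ M′ ⟧ W.embedding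
      G-mono : ∀ {x y} → x X.≺ y → G x Y.≺ G y
      G-mono x≺y = inflate-<⇒ L′ c′ (g-strict (inflate-<⇐ L c
        (subst₂ X._≺_ (sym (dec-enc _)) (sym (dec-enc _)) x≺y)))
      κ : Pt → ∣ ⟦ W.K ⟧ₗ ∣
      κ x = proj₁ (P.covers (enc x))
      κ-∈ : ∀ x → P.part (κ x) (enc x)
      κ-∈ x = proj₂ (P.covers (enc x))
      κ-mono : ∀ {x y} → x X.≼ y → κ x K.≤ κ y
      κ-mono {x} {y} x≼y = parts-monotone em W.partition (κ-∈ x) (κ-∈ y)
        (inflate-≤⇐ L c (subst₂ X._≼_ (sym (dec-enc _)) (sym (dec-enc _)) x≼y))
      fill : ∀ x y z → κ x K.≈ κ z → G x Y.≺ y → y Y.≺ G z → ∃[ w ] G w ≡ y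
      fill x y z x~z Gx≺y y≺Gz =
        let t , _ , gt≡y = W.convex (κ x)
              (inflate-≤⇐ L′ c′ (inj₁ (subst (G x Y.≺_) (sym (dec-enc y)) Gx≺y)))
              (inflate-≤⇐ L′ c′ (inj₁ (subst (Y._≺ G z) (sym (dec-enc y)) y≺Gz)))
              (enc x , κ-∈ x , refl)
              (enc z , subst (λ k → P.part k (enc z)) (sym (Dom-≡ {Lin.code W.K} x~z)) (κ-∈ z) , refl)
        in dec t , trans (cong (dec ∘ g) (enc-dec t)) (trans (cong dec gt≡y) (dec-enc y))
      open Recover em L c L′ c′ ⟦ W.K ⟧ₗ (scattered W.K∈𝓛) G G-mono κ κ-mono fill
      open Choice (proj₁ ∘ choice) (proj₂ ∘ choice)

theorem6p9 : Classical → (𝓛 : Class) → 𝓛 ⊆ Scat → Satisfiable 𝓛 → DownwardClosed 𝓛 → CCS 𝓛 →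
    BorelEquivalent LOℕ-space LO-space (⊴LOℕ 𝓛) (⊴LO 𝓛)
theorem6p9 em 𝓛 scattered _ downward _ =
  ( inflate , continuous⇒borel inflate-continuous
  , λ (L , c) (L′ , c′) → mk⇔ (inflate-preserves 𝓛 L c L′ c′)
                              (inflate-reflects 𝓛 L c L′ c′ scattered downward) ) ,
  ( (λ L → L , λ _ → 0)
  , continuous⇒borel (λ L n → n , λ _ L~L′ → (λ {i} {j} → L~L′ {i} {j}) , λ {_} _ → refl)
  , λ L L′ → mk⇔ (λ (f , wit) → f , wit , λ _ → refl) (λ (f , wit , _) → f , wit) )
  where open Inflate em
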